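{- For every numerical semigroup $S\neq\mathbb{N}$, $$g(S)=\Lambda(S)-\Theta(S),$$ and consequently $$W(S)=\bigl(e(S)-t(S)-1\bigr)\,n(S)+\sigma(S)+\Theta(S).$$
   Context: $\mathbb{N}=\{0,1,2,\dots\}$. A numerical semigroup is a submonoid $S\subseteq\mathbb{N}$ (under addition) with finite complement $G(S)=\mathbb{N}\setminus S$, whose elements are the gaps. Let $S\ne\mathbb{N}$. $g(S)=|G(S)|$ is the genus, $F=\max G(S)$, $c(S)=F+1$, $n(S)=|S\cap[0,c(S))|$, and $e(S)$ is the cardinality of the unique minimal system of generators of $S$. An integer $f$ is a pseudo-Frobenius number if $f\notin S$ and $f+s\in S$ for all $s\in S\setminus\{0\}$; $\mathrm{PF}(S)$ is the set of these and $t(S)=|\mathrm{PF}(S)|$. The Wilf number is $W(S)=e(S)n(S)-c(S)$. For $y\in\mathbb{Z}$, $\lambda_S(y)=|S\cap[0,y]|$; for an integer $x\in[1,F]$, $\nu_S(x)=|\{f\in\mathrm{PF}(S): f-x\in S\}|$. Define $$\Lambda(S)=\sum_{f\in\mathrm{PF}(S)}\lambda_S(f),\qquad \sigma(S)=\sum_{f\in\mathrm{PF}(S)}|S\cap(f,F]|,\qquad \Theta(S)=\sum_{x\in G(S)}(\nu_S(x)-1).$$ -}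

module Defs where

open import Data.Nat as ℕ using (ℕ; zero; suc; _+_; _∸_; _≤_; _<_; z≤n; s≤s)
import Data.Nat.Properties as ℕₚ
open import Data.Nat.Induction using (<-rec)
open import Data.Integer as ℤ using (ℤ; +_; -[1+_]; 0ℤ; 1ℤ)
import Data.Integer.Properties as ℤₚ
open import Data.List using (List; length; map; filter; foldr; sum; upTo)
open import Data.List.Extrema ℕₚ.≤-totalOrder using (max; xs≤max; argmax-sel)
open import Data.List.Membership.Propositional using (_∈_)
open import Data.List.Membership.Propositional.Properties
  using (∈-filter⁺; ∈-filter⁻; ∈-map⁺; ∈-map⁻; ∈-upTo⁺)
open import Data.List.Relation.Unary.All as All using ()
open import Data.List.Relation.Unary.Unique.Propositional using (Unique)
open import Data.List.Relation.Unary.Unique.Propositional.Properties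
  using (filter⁺; map⁺; upTo⁺)
open import Data.Product using (∃; _×_; _,_; proj₁; proj₂)
open import Data.Sum using (inj₁; inj₂)
open import Data.Empty using (⊥-elim)
open import Function using (id; _∘_)
open import Level using (Level; 0ℓ; _⊔_)
open import Relation.Binary.PropositionalEquality
  using (_≡_; _≢_; refl; sym; trans; cong; subst)
open import Relation.Nullary using (¬_; Dec; yes; no)
open import Relation.Nullary.Decidable using (map′; _×-dec_; ¬?; decidable-stable)
open import Relation.Unary using (Pred; Decidable; ∁; _⊆_; _≐_)

private
  variable
    a p q : Level

------------------------------------------------------------------------
-- Finite sets and cardinalities

-- A proof that the set {x | P x} is finite.  The length of the list does
-- not depend on the enumeration chosen, so it is the cardinality of the set.
record Finite {A : Set a} (P : Pred A p) : Set (a ⊔ p) where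
  field
    elements : List A
    unique   : Unique elements
    sound    : ∀ {x} → x ∈ elements → P x
    complete : ∀ {x} → P x → x ∈ elements

open Finite public

∣_∣ : {A : Set a} {P : Pred A p} → Finite P → ℕ
∣ X ∣ = length (elements X)

∑ℕ : {A : Set a} {P : Pred A p} → Finite P → (A → ℕ) → ℕ
∑ℕ X h = sum (map h (elements X))

∑ℤ : {A : Set a} {P : Pred A p} → Finite P → (A → ℤ) → ℤ
∑ℤ X h = foldr ℤ._+_ 0ℤ (map h (elements X))

restrict : {A : Set a} {P : Pred A p} {Q : Pred A q} →
           Decidable Q → Finite P → Finite (λ x → P x × Q x)
restrict Q? X = record
  { elements = filter Q? (elements X)
  ; unique   = filter⁺ Q? (unique X)
  ; sound    = λ m → let i , Qx = ∈-filter⁻ Q? {xs = elements X} m in sound X i , Qx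
  ; complete = λ (Px , Qx) → ∈-filter⁺ Q? (complete X Px) Qx
  }

boundedFinite : {P : Pred ℕ p} → Decidable P →
                ∀ N → (∀ {n} → P n → n < N) → Finite P
boundedFinite P? N bound = record
  { elements = filter P? (upTo N)
  ; unique   = filter⁺ P? (upTo⁺ N)
  ; sound    = λ m → proj₂ (∈-filter⁻ P? {xs = upTo N} m)
  ; complete = λ Pn → ∈-filter⁺ P? (∈-upTo⁺ (bound Pn)) Pn
  }

IsMaximum : Pred ℕ p → ℕ → Set p
IsMaximum P m = P m × (∀ n → P n → n ≤ m)

------------------------------------------------------------------------
-- Numerical semigroups

-- Membership is taken to be decidable, as it is classically for every subset.
record NumericalSemigroup : Set₁ where
  field
    Member   : Pred ℕ 0ℓ
    member?  : Decidable Member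
    0∈       : Member 0
    +-closed : ∀ {m n} → Member m → Member n → Member (m + n)
    gaps     : Finite (∁ Member)

open NumericalSemigroup public

infix 4 _∈ˢ_ _∈ᶻ_

_∈ˢ_ : ℕ → NumericalSemigroup → Set
n ∈ˢ S = Member S n

_∈ᶻ_ : ℤ → NumericalSemigroup → Set
z ∈ᶻ S = ∃ λ n → z ≡ + n × n ∈ˢ S

Gap : NumericalSemigroup → Pred ℕ 0ℓ
Gap S = ∁ (Member S)

≢ℕ : NumericalSemigroup → Set
≢ℕ S = ¬ (∀ n → n ∈ˢ S)

_∈ᶻ?_ : ∀ z S → Dec (z ∈ᶻ S)
(+ n)    ∈ᶻ? S = map′ (λ n∈S → n , refl , n∈S) (λ { (_ , refl , n∈S) → n∈S }) (member? S n)
-[1+ n ] ∈ᶻ? S = no λ { (_ , () , _) }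

-- A bound beyond which everything lies in S; it also makes sense for S = ℕ.
bound : NumericalSemigroup → ℕ
bound S = suc (max 0 (elements (gaps S)))

gap<bound : ∀ S {n} → Gap S n → n < bound S
gap<bound S n∉S = s≤s (All.lookup (xs≤max 0 (elements (gaps S))) (complete (gaps S) n∉S))

bound≤⇒∈ : ∀ S {n} → bound S ≤ n → n ∈ˢ S
bound≤⇒∈ S {n} b≤n =
  decidable-stable (member? S n) (λ n∉S → ℕₚ.<⇒≱ (gap<bound S n∉S) b≤n)

------------------------------------------------------------------------
-- Genus, Frobenius number, conductor

genus : NumericalSemigroup → ℕ
genus S = ∣ gaps S ∣

frobeniusNumber : ∀ S → ≢ℕ S → ∃ (IsMaximum (Gap S))
frobeniusNumber S S≢ℕ = m , m-gap , λ n n∉S → ℕₚ.≤-pred (gap<bound S n∉S)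
  where
  m = max 0 (elements (gaps S))
  m-gap : Gap S m
  m-gap with argmax-sel id 0 (elements (gaps S))
  ... | inj₂ m∈gaps = sound (gaps S) m∈gaps
  ... | inj₁ m≡0    = λ _ → S≢ℕ all∈S
    where
    all∈S : ∀ n → n ∈ˢ S
    all∈S zero    = 0∈ S
    all∈S (suc n) = bound≤⇒∈ S (subst (λ k → suc k ≤ suc n) (sym m≡0) (s≤s z≤n))

F : ∀ S → ≢ℕ S → ℕ
F S S≢ℕ = proj₁ (frobeniusNumber S S≢ℕ)

conductor : ∀ S → ≢ℕ S → ℕ
conductor S S≢ℕ = F S S≢ℕ + 1

------------------------------------------------------------------------
-- Counting elements of S in intervals

-- S ∩ [0, c(S))
elementsBelowConductor : ∀ S (S≢ℕ : ≢ℕ S) →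
  Finite (λ n → n ∈ˢ S × n < conductor S S≢ℕ)
elementsBelowConductor S S≢ℕ =
  boundedFinite (λ n → member? S n ×-dec (n ℕ.<? conductor S S≢ℕ)) (conductor S S≢ℕ) proj₂

n : ∀ S → ≢ℕ S → ℕ
n S S≢ℕ = ∣ elementsBelowConductor S S≢ℕ ∣

-- S ∩ [0, y]
elementsUpTo : ∀ S (y : ℤ) → Finite (λ s → s ∈ˢ S × + s ℤ.≤ y)
elementsUpTo S y =
  boundedFinite (λ s → member? S s ×-dec (+ s ℤ.≤? y)) (suc ℤ.∣ y ∣) (λ (_ , s≤y) → lt s≤y)
  where
  lt : ∀ {s y} → + s ℤ.≤ y → s < suc ℤ.∣ y ∣
  lt (ℤ.+≤+ s≤y) = s≤s s≤y

lam : NumericalSemigroup → ℤ → ℕ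
lam S y = ∣ elementsUpTo S y ∣

-- S ∩ (f, F]
elementsAbove : ∀ S (S≢ℕ : ≢ℕ S) (f : ℤ) →
  Finite (λ s → s ∈ˢ S × f ℤ.< + s × s ≤ F S S≢ℕ)
elementsAbove S S≢ℕ f =
  boundedFinite (λ s → member? S s ×-dec ((f ℤ.<? + s) ×-dec (s ℕ.≤? F S S≢ℕ)))
    (suc (F S S≢ℕ)) (λ (_ , _ , s≤F) → s≤s s≤F)

------------------------------------------------------------------------
-- Pseudo-Frobenius numbers

IsPseudoFrobenius : NumericalSemigroup → Pred ℤ 0ℓ
IsPseudoFrobenius S f =
  ¬ (f ∈ᶻ S) × (∀ s → s ∈ˢ S → s ≢ 0 → f ℤ.+ + s ∈ᶻ S)

+∈ᶻ⇒∈ : ∀ {S m} → + m ∈ᶻ S → m ∈ˢ S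
+∈ᶻ⇒∈ (_ , refl , m∈S) = m∈S

∈⇒+∈ᶻ : ∀ {S m} → m ∈ˢ S → + m ∈ᶻ S
∈⇒+∈ᶻ m∈S = _ , refl , m∈S

isPseudoFrobenius⁺? : ∀ S m → Dec (IsPseudoFrobenius S (+ m))
isPseudoFrobenius⁺? S m =
  map′ to from (¬? (member? S m) ×-dec ℕₚ.allUpTo? ok? (bound S))
  where
  Ok : Pred ℕ 0ℓ
  Ok s = ¬ (s ∈ˢ S × s ≢ 0 × ¬ (m + s ∈ˢ S))
  ok? : Decidable Ok
  ok? s = ¬? (member? S s ×-dec (¬? (s ℕ.≟ 0) ×-dec ¬? (member? S (m + s))))
  to : ¬ (m ∈ˢ S) × (∀ {s} → s < bound S → Ok s) → IsPseudoFrobenius S (+ m)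
  to (m∉S , ok) = (m∉S ∘ +∈ᶻ⇒∈ {S}) , λ s s∈S s≢0 → ∈⇒+∈ᶻ {S} (step s s∈S s≢0)
    where
    step : ∀ s → s ∈ˢ S → s ≢ 0 → m + s ∈ˢ S
    step s s∈S s≢0 = decidable-stable (member? S (m + s)) λ m+s∉S →
      ok (ℕₚ.≤-<-trans (ℕₚ.m≤n+m s m) (gap<bound S m+s∉S)) (s∈S , s≢0 , m+s∉S)
  from : IsPseudoFrobenius S (+ m) → ¬ (m ∈ˢ S) × (∀ {s} → s < bound S → Ok s)
  from (m∉S , pf) = (m∉S ∘ ∈⇒+∈ᶻ {S}) ,
    λ _ (s∈S , s≢0 , m+s∉S) → m+s∉S (+∈ᶻ⇒∈ {S} (pf _ s∈S s≢0))

¬isPseudoFrobenius⁻ : ∀ S → ≢ℕ S → ∀ k → ¬ IsPseudoFrobenius S -[1+ k ]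
¬isPseudoFrobenius⁻ S S≢ℕ k (_ , pf) = F∉S (+∈ᶻ⇒∈ {S} (subst (_∈ᶻ S) eq (pf s s∈S λ ())))
  where
  F∉S = proj₁ (proj₂ (frobeniusNumber S S≢ℕ))
  s = suc k + F S S≢ℕ
  s∈S : s ∈ˢ S
  s∈S = bound≤⇒∈ S (s≤s (ℕₚ.m≤n+m (F S S≢ℕ) k))
  eq : -[1+ k ] ℤ.+ + s ≡ + F S S≢ℕ
  eq = trans (ℤₚ.⊖-≥ (ℕₚ.m≤m+n (suc k) (F S S≢ℕ))) (cong +_ (ℕₚ.m+n∸m≡n (suc k) (F S S≢ℕ)))

PF : ∀ S → ≢ℕ S → Finite (IsPseudoFrobenius S)
PF S S≢ℕ = record
  { elements = map +_ (elements nonneg)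
  ; unique   = map⁺ ℤₚ.+-injective (unique nonneg)
  ; sound    = λ m → snd (∈-map⁻ +_ m)
  ; complete = cmp _
  }
  where
  nonneg : Finite (λ m → IsPseudoFrobenius S (+ m))
  nonneg = boundedFinite (isPseudoFrobenius⁺? S) (bound S)
             (λ (m∉S , _) → gap<bound S (m∉S ∘ ∈⇒+∈ᶻ {S}))
  snd : ∀ {z} → ∃ (λ m → m ∈ elements nonneg × z ≡ + m) → IsPseudoFrobenius S z
  snd (_ , m∈ , refl) = sound nonneg m∈
  cmp : ∀ z → IsPseudoFrobenius S z → z ∈ map +_ (elements nonneg)
  cmp (+ m)    pf = ∈-map⁺ +_ (complete nonneg pf)
  cmp -[1+ k ] pf = ⊥-elim (¬isPseudoFrobenius⁻ S S≢ℕ k pf)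

type : ∀ S → ≢ℕ S → ℕ
type S S≢ℕ = ∣ PF S S≢ℕ ∣

-- {f ∈ PF(S) | f - x ∈ S}.  Only the values at x ∈ [1, F] are of interest.
PF-above : ∀ S (S≢ℕ : ≢ℕ S) (x : ℕ) →
  Finite (λ f → IsPseudoFrobenius S f × f ℤ.- + x ∈ᶻ S)
PF-above S S≢ℕ x = restrict (λ f → (f ℤ.- + x) ∈ᶻ? S) (PF S S≢ℕ)

ν : ∀ S → ≢ℕ S → ℕ → ℕ
ν S S≢ℕ x = ∣ PF-above S S≢ℕ x ∣

------------------------------------------------------------------------
-- Minimal systems of generators and embedding dimension

-- The submonoid of ℕ generated by A.
data ⟨_⟩ (A : Pred ℕ 0ℓ) : Pred ℕ 0ℓ where
  unit : ⟨ A ⟩ 0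
  gen  : ∀ {x} → A x → ⟨ A ⟩ x
  add  : ∀ {x y} → ⟨ A ⟩ x → ⟨ A ⟩ y → ⟨ A ⟩ (x + y)

Generates : Pred ℕ 0ℓ → NumericalSemigroup → Set
Generates A S = ⟨ A ⟩ ≐ Member S

-- A generates S and no proper subset of A does.
IsMinimalSystem : Pred ℕ 0ℓ → NumericalSemigroup → Set₁
IsMinimalSystem A S =
  Generates A S × (∀ (B : Pred ℕ 0ℓ) → B ⊆ A → Generates B S → A ⊆ B)

record MinimalSystem (S : NumericalSemigroup) : Set₁ where
  field
    generators : Pred ℕ 0ℓ
    isMinimal  : IsMinimalSystem generators S
    finite     : Finite generators

open MinimalSystem public

module _ (S : NumericalSemigroup) where

  private
    Split : ℕ → Pred ℕ 0ℓ
    Split n x = x ≢ 0 × x ∈ˢ S × n ∸ x ∈ˢ S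

    Reducible : Pred ℕ 0ℓ
    Reducible n = ∃ λ x → x < n × Split n x

    reducible? : Decidable Reducible
    reducible? n =
      ℕₚ.anyUpTo? (λ x → ¬? (x ℕ.≟ 0) ×-dec (member? S x ×-dec member? S (n ∸ x))) n

    Irreducible : Pred ℕ 0ℓ
    Irreducible n = n ∈ˢ S × n ≢ 0 × ¬ Reducible n

    irreducible? : Decidable Irreducible
    irreducible? n = member? S n ×-dec (¬? (n ℕ.≟ 0) ×-dec ¬? (reducible? n))

    ⟨⟩⊆S : ∀ {A} → A ⊆ Member S → ⟨ A ⟩ ⊆ Member S
    ⟨⟩⊆S A⊆S unit      = 0∈ S
    ⟨⟩⊆S A⊆S (gen x∈A) = A⊆S x∈A
    ⟨⟩⊆S A⊆S (add u v) = +-closed S (⟨⟩⊆S A⊆S u) (⟨⟩⊆S A⊆S v)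

    S⊆⟨irr⟩ : ∀ n → n ∈ˢ S → ⟨ Irreducible ⟩ n
    S⊆⟨irr⟩ = <-rec (λ n → n ∈ˢ S → ⟨ Irreducible ⟩ n) step
      where
      step : ∀ n → (∀ {m} → m < n → m ∈ˢ S → ⟨ Irreducible ⟩ m) →
             n ∈ˢ S → ⟨ Irreducible ⟩ n
      step zero      _   _   = unit
      step n@(suc _) rec n∈S with reducible? n
      ... | no  n-irr = gen (n∈S , (λ ()) , n-irr)
      ... | yes (zero , _ , x≢0 , _) = ⊥-elim (x≢0 refl)
      ... | yes (x@(suc x-1) , x<n , x≢0 , x∈S , n-x∈S) =
        subst ⟨ Irreducible ⟩ (ℕₚ.m+[n∸m]≡n (ℕₚ.<⇒≤ x<n))
          (add (rec x<n x∈S) (rec (s≤s (ℕₚ.m∸n≤m _ x-1)) n-x∈S))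

    irr⊆ : ∀ B → B ⊆ Member S → ∀ {n} → ⟨ B ⟩ n → Irreducible n → B n
    irr⊆ B B⊆S unit      (_ , 0≢0 , _) = ⊥-elim (0≢0 refl)
    irr⊆ B B⊆S (gen n∈B) _             = n∈B
    irr⊆ B B⊆S (add {zero}  {y} u v) irr = irr⊆ B B⊆S v irr
    irr⊆ B B⊆S (add {suc x} {zero} u v) irr =
      subst B (sym (ℕₚ.+-identityʳ (suc x)))
        (irr⊆ B B⊆S u (subst Irreducible (ℕₚ.+-identityʳ (suc x)) irr))
    irr⊆ B B⊆S (add {suc x} {suc y} u v) (_ , _ , n-irr) =
      ⊥-elim (n-irr (suc x , ℕₚ.m<m+n (suc x) (s≤s z≤n) , (λ ()) , ⟨⟩⊆S B⊆S u ,
        subst (_∈ˢ S) (sym (ℕₚ.m+n∸m≡n (suc x) (suc y))) (⟨⟩⊆S B⊆S v)))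

    irr-generates : Generates Irreducible S
    irr-generates = ⟨⟩⊆S proj₁ , S⊆⟨irr⟩ _

    irr-bounded : ∀ {n} → Irreducible n → n < bound S + bound S
    irr-bounded {n} (_ , _ , n-irr) = ℕₚ.≰⇒> λ 2b≤n →
      n-irr (bound S ,
        ℕₚ.<-≤-trans (ℕₚ.m<m+n (bound S) (s≤s z≤n)) 2b≤n ,
        (λ ()) , bound≤⇒∈ S ℕₚ.≤-refl ,
        bound≤⇒∈ S (subst (_≤ n ∸ bound S) (ℕₚ.m+n∸n≡m (bound S) (bound S))
                     (ℕₚ.∸-monoˡ-≤ (bound S) 2b≤n)))

  minimalSystem : MinimalSystem S
  minimalSystem = record
    { generators = Irreducible
    ; isMinimal  = irr-generates , λ B B⊆irr (_ , S⊆⟨B⟩) irr →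
        irr⊆ B (proj₁ ∘ B⊆irr) (S⊆⟨B⟩ (proj₁ irr)) irr
    ; finite     = boundedFinite irreducible? (bound S + bound S) irr-bounded
    }

  minimalSystem-unique : ∀ A → IsMinimalSystem A S → A ≐ generators minimalSystem
  minimalSystem-unique A ((⟨A⟩⊆S , S⊆⟨A⟩) , A-min) = A-min Irreducible irr⊆A irr-generates , irr⊆A
    where
    irr⊆A : Irreducible ⊆ A
    irr⊆A irr = irr⊆ A (⟨A⟩⊆S ∘ gen) (S⊆⟨A⟩ (proj₁ irr)) irr

e : NumericalSemigroup → ℕ
e S = ∣ finite (minimalSystem S) ∣

------------------------------------------------------------------------
-- The Wilf number and the sums Λ, σ, Θ

W : ∀ S → ≢ℕ S → ℤ
W S S≢ℕ = + e S ℤ.* + n S S≢ℕ ℤ.- + conductor S S≢ℕ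

Λ : ∀ S → ≢ℕ S → ℕ
Λ S S≢ℕ = ∑ℕ (PF S S≢ℕ) (lam S)

σ : ∀ S → ≢ℕ S → ℕ
σ S S≢ℕ = ∑ℕ (PF S S≢ℕ) (λ f → ∣ elementsAbove S S≢ℕ f ∣)

Θ : ∀ S → ≢ℕ S → ℤ
Θ S S≢ℕ = ∑ℤ (gaps S) (λ x → + ν S S≢ℕ x ℤ.- 1ℤ)

{-# OPTIONS --safe #-}
module Submission where

-- Count the pairs (f, x) with f ∈ PF(S), x a gap and f - x ∈ S.  For fixed x
-- there are ν(x) of them; for fixed f, the reflection s ↦ f - s turns them into
-- the s ∈ S ∩ [0, f], since f - s ∈ S would force f ∈ S.  Hence Λ = ∑ ν = Θ + g.
-- The formula for W follows from λ(f) + |S ∩ (f, F]| = n and n + g = c.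

open import Defs
open import Data.Integer using (+_; _+_; _-_; _*_; 1ℤ)
open import Data.Product using (_×_)
open import Relation.Binary.PropositionalEquality using (_≡_)

open import Data.Bool using (if_then_else_)
open import Data.Empty using (⊥)
open import Data.Integer as ℤ using (ℤ; 0ℤ; +≤+)
import Data.Integer.Properties as ℤₚ
open import Data.Integer.Tactic.RingSolver using (solve-∀)
open import Data.List using (List; []; _∷_; _++_; length; map; filter; foldr; upTo)
open import Data.List.Membership.Propositional.Properties
  using (∈-map⁺; ∈-map⁻; ∈-++⁺ˡ; ∈-++⁺ʳ; ∈-++⁻; ∈-upTo⁺; ∈-upTo⁻)
open import Data.List.Membership.Propositional.Properties.WithK using (unique∧set⇒bag)
open import Data.List.Properties using (length-map; length-++; length-upTo; map-cong; map-cong-local)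
open import Data.List.Relation.Binary.BagAndSetEquality using (∼bag⇒↭)
open import Data.List.Relation.Binary.Permutation.Propositional.Properties using (↭-length)
import Data.List.Relation.Unary.All as All
open import Data.List.Relation.Unary.Unique.Propositional.Properties using (map⁺; ++⁺; upTo⁺)
open import Data.Nat as ℕ using (ℕ)
open import Data.Nat.ListAction using (sum)
import Data.Nat.Properties as ℕₚ
open import Algebra.Properties.CommutativeSemigroup ℕₚ.+-commutativeSemigroup using (interchange)
open import Data.Product using (∃; _,_; proj₁; proj₂)
open import Data.Sum using (inj₁; inj₂; [_,_]′)
open import Function using (_∘_)
open import Function.Bundles using (mk⇔)
open import Function.Definitions using (Injective)
open import Level using (Level)
open import Relation.Binary.Definitions using () renaming (Decidable to Decidable₂)
open import Relation.Binary.PropositionalEquality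
  using (refl; sym; trans; cong; cong₂; subst; module ≡-Reasoning)
open import Relation.Nullary using (¬_; Dec; does; yes; no)
open import Relation.Unary using (Pred; Decidable; _∪_; _≐_)

private
  variable
    a b p q r : Level
    A : Set a
    B : Set b
    P : Pred A p
    Q : Pred A q
    R : Pred A r

-- Sums over lists and exchange of summation.

sum-map-0 : (xs : List A) → sum (map (λ _ → 0) xs) ≡ 0
sum-map-0 []       = refl
sum-map-0 (_ ∷ xs) = sum-map-0 xs

sum-map-+ : (h k : A → ℕ) (xs : List A) →
            sum (map (λ x → h x ℕ.+ k x) xs) ≡ sum (map h xs) ℕ.+ sum (map k xs)
sum-map-+ h k []       = refl
sum-map-+ h k (x ∷ xs) = trans (cong (h x ℕ.+ k x ℕ.+_) (sum-map-+ h k xs))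
                               (interchange (h x) (k x) _ _)

sum-map-const : (c : ℕ) (xs : List A) → sum (map (λ _ → c) xs) ≡ length xs ℕ.* c
sum-map-const c []       = refl
sum-map-const c (_ ∷ xs) = cong (c ℕ.+_) (sum-map-const c xs)

sum-swap : (h : A → B → ℕ) (xs : List A) (ys : List B) →
  sum (map (λ x → sum (map (h x) ys)) xs) ≡ sum (map (λ y → sum (map (λ x → h x y) xs)) ys)
sum-swap h []       ys = sym (sum-map-0 ys)
sum-swap h (x ∷ xs) ys = trans (cong (sum (map (h x) ys) ℕ.+_) (sum-swap h xs ys))
                               (sym (sum-map-+ (h x) _ ys))

-- Turns a cardinality into a sum, so that double counting becomes an exchange of two summations.
indicator : {P : Set p} → Dec P → ℕ
indicator P? = if does P? then 1 else 0

length-filter : {P : Pred A p} (P? : Decidable P) (xs : List A) →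
                length (filter P? xs) ≡ sum (map (indicator ∘ P?) xs)
length-filter P? []       = refl
length-filter P? (x ∷ xs) with P? x
... | yes _ = cong ℕ.suc (length-filter P? xs)
... | no  _ = length-filter P? xs

foldr-map-minus-1 : (h : A → ℕ) (xs : List A) →
  foldr _+_ 0ℤ (map (λ x → + h x - 1ℤ) xs) ≡ + sum (map h xs) - + length xs
foldr-map-minus-1 h []       = refl
foldr-map-minus-1 h (x ∷ xs) =
  trans (cong (λ i → + h x - 1ℤ + i) (foldr-map-minus-1 h xs)) (rearrange (+ h x) (+ sum (map h xs)) (+ length xs))
  where
  rearrange : ∀ i j k → i - 1ℤ + (j - k) ≡ i + j - (1ℤ + k)
  rearrange = solve-∀

-- Cardinalities of finite sets and double counting.

∑ℕ-cong : (X : Finite P) {h k : A → ℕ} → (∀ {x} → P x → h x ≡ k x) → ∑ℕ X h ≡ ∑ℕ X k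
∑ℕ-cong X h≡k = cong sum (map-cong-local (All.tabulate (h≡k ∘ sound X)))

-- Both sides count the pairs in `R`, by rows and by columns: each restriction has as many elements
-- as its indicators sum to.
∑ℕ-∣restrict∣-swap : {R : A → B → Set r} (R? : Decidable₂ R) (X : Finite P) (Y : Finite Q) →
  ∑ℕ X (λ x → ∣ restrict (R? x) Y ∣) ≡ ∑ℕ Y (λ y → ∣ restrict (λ x → R? x y) X ∣)
∑ℕ-∣restrict∣-swap R? X Y = begin
  ∑ℕ X (λ x → ∣ restrict (R? x) Y ∣)
    ≡⟨ cong sum (map-cong (λ x → length-filter (R? x) (elements Y)) (elements X)) ⟩
  ∑ℕ X (λ x → ∑ℕ Y (λ y → indicator (R? x y)))
    ≡⟨ sum-swap (λ x y → indicator (R? x y)) (elements X) (elements Y) ⟩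
  ∑ℕ Y (λ y → ∑ℕ X (λ x → indicator (R? x y)))
    ≡⟨ cong sum (map-cong (λ y → length-filter (λ x → R? x y) (elements X)) (elements Y)) ⟨
  ∑ℕ Y (λ y → ∣ restrict (λ x → R? x y) X ∣) ∎
  where open ≡-Reasoning

-- Two duplicate-free lists with the same members are equal as bags, hence permutations of each
-- other.
∣∣-cong : (X : Finite P) (Y : Finite Q) → P ≐ Q → ∣ X ∣ ≡ ∣ Y ∣
∣∣-cong X Y (P⊆Q , Q⊆P) = ↭-length (∼bag⇒↭ (unique∧set⇒bag (unique X) (unique Y)
  (mk⇔ (complete Y ∘ P⊆Q ∘ sound X) (complete X ∘ Q⊆P ∘ sound Y))))

image : (h : A → B) → Injective _≡_ _≡_ h → Finite P → Finite (λ y → ∃ λ x → P x × y ≡ h x)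
image h h-inj X = record
  { elements = map h (elements X)
  ; unique   = map⁺ h-inj (unique X)
  ; sound    = λ m → let x , x∈X , y≡hx = ∈-map⁻ h m in x , sound X x∈X , y≡hx
  ; complete = λ { (_ , Px , refl) → ∈-map⁺ h (complete X Px) }
  }

disjointUnion : (∀ {x} → P x → Q x → ⊥) → Finite P → Finite Q → Finite (P ∪ Q)
disjointUnion disjoint X Y = record
  { elements = elements X ++ elements Y
  ; unique   = ++⁺ (unique X) (unique Y) (λ (x∈X , x∈Y) → disjoint (sound X x∈X) (sound Y x∈Y))
  ; sound    = [ inj₁ ∘ sound X , inj₂ ∘ sound Y ]′ ∘ ∈-++⁻ (elements X)
  ; complete = [ ∈-++⁺ˡ ∘ complete X , ∈-++⁺ʳ (elements X) ∘ complete Y ]′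
  }

-- Concatenating the two enumerations repeats nothing, and `∣∣-cong` compares the result with the
-- given enumeration of `R`.
∣∣-disjointUnion : (∀ {x} → P x → Q x → ⊥) → (X : Finite P) (Y : Finite Q) (Z : Finite R) →
                   P ∪ Q ≐ R → ∣ X ∣ ℕ.+ ∣ Y ∣ ≡ ∣ Z ∣
∣∣-disjointUnion disjoint X Y Z P∪Q≐R =
  trans (sym (length-++ (elements X))) (∣∣-cong (disjointUnion disjoint X Y) Z P∪Q≐R)

-- Reflection in a pseudo-Frobenius number.

+-closedᶻ : ∀ S {y z} → y ∈ᶻ S → z ∈ᶻ S → y + z ∈ᶻ S
+-closedᶻ S (_ , refl , m∈S) (_ , refl , n∈S) = _ , refl , +-closed S m∈S n∈S

i-[i-j] : ∀ i j → i - (i - j) ≡ j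
i-[i-j] = solve-∀

[i-j]+j : ∀ i j → i - j + j ≡ i
[i-j]+j = solve-∀

-- The reflection undoes itself, by `i-[i-j]`.
reflect-injective : ∀ i → Injective _≡_ _≡_ (λ m → i - + m)
reflect-injective i {m} {n} eq =
  ℤₚ.+-injective (trans (sym (i-[i-j] i (+ m))) (trans (cong (i -_) eq) (i-[i-j] i (+ n))))

gapsReflectedInto : ∀ S (f : ℤ) → Finite (λ x → Gap S x × f - + x ∈ᶻ S)
gapsReflectedInto S f = restrict (λ x → (f - + x) ∈ᶻ? S) (gaps S)

-- Both sets consist of naturals, but `f - + s` is an integer. So both are sent injectively into ℤ,
-- one by the reflection and the other by the inclusion `+_`, and the two images coincide.
lam-reflect : ∀ S {f} → ¬ (f ∈ᶻ S) → lam S f ≡ ∣ gapsReflectedInto S f ∣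
lam-reflect S {f} f∉S = begin
  ∣ elementsUpTo S f ∣       ≡⟨ length-map (λ s → f - + s) (elements (elementsUpTo S f)) ⟨
  ∣ reflected ∣              ≡⟨ ∣∣-cong reflected embedded (to , from) ⟩
  ∣ embedded ∣               ≡⟨ length-map +_ (elements (gapsReflectedInto S f)) ⟩
  ∣ gapsReflectedInto S f ∣  ∎
  where
  open ≡-Reasoning
  reflected = image (λ s → f - + s) (reflect-injective f) (elementsUpTo S f)
  embedded  = image +_ ℤₚ.+-injective (gapsReflectedInto S f)

  to : ∀ {z} → ∃ (λ s → (s ∈ˢ S × + s ℤ.≤ f) × z ≡ f - + s) →
       ∃ (λ x → (Gap S x × f - + x ∈ᶻ S) × z ≡ + x)
  to (s , (s∈S , s≤f) , refl) = x , (x∉S , f-x∈S) , sym x≡f-s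
    where
    -- The absolute value makes `f - + s` a natural number; since `s≤f`, it changes nothing.
    x = ℤ.∣ f - + s ∣
    x≡f-s : + x ≡ f - + s
    x≡f-s = ℤₚ.0≤i⇒+∣i∣≡i (ℤₚ.i≤j⇒0≤j-i s≤f)
    x∉S : Gap S x
    x∉S x∈S = f∉S (subst (_∈ᶻ S) (trans (cong (_+ + s) x≡f-s) ([i-j]+j f (+ s)))
                     (+-closedᶻ S (∈⇒+∈ᶻ {S} x∈S) (∈⇒+∈ᶻ {S} s∈S)))
    f-x∈S : f - + x ∈ᶻ S
    f-x∈S = s , trans (cong (f -_) x≡f-s) (i-[i-j] f (+ s)) , s∈S

  from : ∀ {z} → ∃ (λ x → (Gap S x × f - + x ∈ᶻ S) × z ≡ + x) →
         ∃ (λ s → (s ∈ˢ S × + s ℤ.≤ f) × z ≡ f - + s)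
  from (x , (_ , s , f-x≡s , s∈S) , refl) = s , (s∈S , s≤f) , sym f-s≡x
    where
    f-s≡x : f - + s ≡ + x
    f-s≡x = trans (cong (f -_) (sym f-x≡s)) (i-[i-j] f (+ x))
    s≤f : + s ℤ.≤ f
    -- The difference `f - + s` is the natural number `x`, hence nonnegative.
    s≤f = ℤₚ.0≤i-j⇒j≤i (subst (0ℤ ℤ.≤_) (sym f-s≡x) (+≤+ ℕ.z≤n))

-- Each `f` in PF(S) lies outside S, so `lam-reflect` applies termwise. After the exchange the inner
-- count is `ν` by definition, as `PF-above` is a restriction of `PF`.
Λ≡∑ν : ∀ S (S≢ℕ : ≢ℕ S) → Λ S S≢ℕ ≡ ∑ℕ (gaps S) (ν S S≢ℕ)
Λ≡∑ν S S≢ℕ = trans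
  (∑ℕ-cong (PF S S≢ℕ) (lam-reflect S ∘ proj₁))
  (∑ℕ-∣restrict∣-swap (λ f x → (f - + x) ∈ᶻ? S) (PF S S≢ℕ) (gaps S))

Θ≡Λ-genus : ∀ S (S≢ℕ : ≢ℕ S) → Θ S S≢ℕ ≡ + Λ S S≢ℕ - + genus S
Θ≡Λ-genus S S≢ℕ = trans
  (foldr-map-minus-1 (ν S S≢ℕ) (elements (gaps S)))
  (cong (λ m → + m - + genus S) (sym (Λ≡∑ν S S≢ℕ)))

-- Counting below the conductor.

gap≤F : ∀ S (S≢ℕ : ≢ℕ S) {x} → Gap S x → x ℕ.≤ F S S≢ℕ
gap≤F S S≢ℕ = proj₂ (proj₂ (frobeniusNumber S S≢ℕ)) _

≤F⇒<conductor : ∀ S (S≢ℕ : ≢ℕ S) {x} → x ℕ.≤ F S S≢ℕ → x ℕ.< conductor S S≢ℕ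
-- The conductor is `F + 1`, which must be commuted before it reads as a successor.
≤F⇒<conductor S S≢ℕ {x} x≤F = subst (x ℕ.<_) (ℕₚ.+-comm 1 (F S S≢ℕ)) (ℕ.s≤s x≤F)

<conductor⇒≤F : ∀ S (S≢ℕ : ≢ℕ S) {x} → x ℕ.< conductor S S≢ℕ → x ℕ.≤ F S S≢ℕ
<conductor⇒≤F S S≢ℕ {x} x<c = ℕ.s≤s⁻¹ (subst (x ℕ.<_) (ℕₚ.+-comm (F S S≢ℕ) 1) x<c)

n+genus≡conductor : ∀ S (S≢ℕ : ≢ℕ S) → n S S≢ℕ ℕ.+ genus S ≡ conductor S S≢ℕ
n+genus≡conductor S S≢ℕ = trans
  (∣∣-disjointUnion (λ (x∈S , _) x∉S → x∉S x∈S) (elementsBelowConductor S S≢ℕ) (gaps S) below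
    ([ proj₂ , ≤F⇒<conductor S S≢ℕ ∘ gap≤F S S≢ℕ ]′ , split))
  (length-upTo c)
  where
  c = conductor S S≢ℕ
  below : Finite (ℕ._< c)
  below = record
    { elements = upTo c ; unique = upTo⁺ c ; sound = ∈-upTo⁻ ; complete = ∈-upTo⁺ }
  split : ∀ {x} → x ℕ.< c → ((λ x → x ∈ˢ S × x ℕ.< c) ∪ Gap S) x
  split {x} x<c with member? S x
  ... | yes x∈S = inj₁ (x∈S , x<c)
  ... | no  x∉S = inj₂ x∉S

pseudoFrobenius≤F : ∀ S (S≢ℕ : ≢ℕ S) {f} → IsPseudoFrobenius S f → f ℤ.≤ + F S S≢ℕ
pseudoFrobenius≤F S S≢ℕ {+ m}          (m∉S , _) = +≤+ (gap≤F S S≢ℕ (m∉S ∘ ∈⇒+∈ᶻ {S}))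
pseudoFrobenius≤F S S≢ℕ {ℤ.-[1+ _ ]} _           = ℤ.-≤+

-- The point `f` cuts S ∩ [0, F] in two; `f≤F` keeps the lower piece below the conductor.
lam+above≡n : ∀ S (S≢ℕ : ≢ℕ S) {f} → f ℤ.≤ + F S S≢ℕ →
              lam S f ℕ.+ ∣ elementsAbove S S≢ℕ f ∣ ≡ n S S≢ℕ
lam+above≡n S S≢ℕ {f} f≤F = ∣∣-disjointUnion
  (λ (_ , s≤f) (_ , f<s , _) → ℤₚ.<⇒≱ f<s s≤f)
  (elementsUpTo S f) (elementsAbove S S≢ℕ f) (elementsBelowConductor S S≢ℕ)
  ( [ (λ (s∈S , s≤f) → s∈S , ≤F⇒<conductor S S≢ℕ (ℤₚ.drop‿+≤+ (ℤₚ.≤-trans s≤f f≤F)))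
    , (λ (s∈S , _ , s≤F) → s∈S , ≤F⇒<conductor S S≢ℕ s≤F) ]′
  , split )
  where
  split : ∀ {s} → s ∈ˢ S × s ℕ.< conductor S S≢ℕ →
          ((λ s → s ∈ˢ S × + s ℤ.≤ f) ∪ (λ s → s ∈ˢ S × f ℤ.< + s × s ℕ.≤ F S S≢ℕ)) s
  split {s} (s∈S , s<c) with + s ℤ.≤? f
  ... | yes s≤f = inj₁ (s∈S , s≤f)
  ... | no  s≰f = inj₂ (s∈S , ℤₚ.≰⇒> s≰f , <conductor⇒≤F S S≢ℕ s<c)

-- Every pseudo-Frobenius number contributes the same total `n` to the two sums together.
Λ+σ≡type*n : ∀ S (S≢ℕ : ≢ℕ S) → Λ S S≢ℕ ℕ.+ σ S S≢ℕ ≡ type S S≢ℕ ℕ.* n S S≢ℕ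
Λ+σ≡type*n S S≢ℕ = begin
  Λ S S≢ℕ ℕ.+ σ S S≢ℕ
    ≡⟨ sum-map-+ (lam S) _ (elements (PF S S≢ℕ)) ⟨
  ∑ℕ (PF S S≢ℕ) (λ f → lam S f ℕ.+ ∣ elementsAbove S S≢ℕ f ∣)
    ≡⟨ ∑ℕ-cong (PF S S≢ℕ) (lam+above≡n S S≢ℕ ∘ pseudoFrobenius≤F S S≢ℕ) ⟩
  ∑ℕ (PF S S≢ℕ) (λ _ → n S S≢ℕ)
    ≡⟨ sum-map-const (n S S≢ℕ) (elements (PF S S≢ℕ)) ⟩
  type S S≢ℕ ℕ.* n S S≢ℕ ∎
  where open ≡-Reasoning

proposition3p2 : (S : NumericalSemigroup) (S≢ℕ : ≢ℕ S) →
    (+ genus S ≡ + Λ S S≢ℕ - Θ S S≢ℕ)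
    × (W S S≢ℕ ≡ (+ e S - + type S S≢ℕ - 1ℤ) * + n S S≢ℕ + + σ S S≢ℕ + Θ S S≢ℕ)
proposition3p2 S S≢ℕ = genus-formula , wilf-formula
  where
  open ≡-Reasoning
  g = + genus S
  l = + Λ S S≢ℕ
  s = + σ S S≢ℕ
  t = + type S S≢ℕ
  N = + n S S≢ℕ

  genus-formula : g ≡ l - Θ S S≢ℕ
  genus-formula = sym (trans (cong (l -_) (Θ≡Λ-genus S S≢ℕ)) (i-[i-j] l g))

  l+s≡t*N : l + s ≡ t * N
  l+s≡t*N = trans (cong +_ (Λ+σ≡type*n S S≢ℕ)) (ℤₚ.pos-* (type S S≢ℕ) (n S S≢ℕ))

  -- Inserts `l + s` and takes it away again: the group `l + s` is to become `t * N`, and the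
  -- leftover `l - g` is to become Θ.
  cancel : ∀ E N g l s → E * N - (N + g) ≡ E * N - (l + s) - N + s + (l - g)
  cancel = solve-∀

  collect : ∀ E t N → E * N - t * N - N ≡ (E - t - 1ℤ) * N
  collect = solve-∀

  wilf-formula : W S S≢ℕ ≡ (+ e S - t - 1ℤ) * N + s + Θ S S≢ℕ
  wilf-formula = begin
    + e S * N - + conductor S S≢ℕ
      -- The embedding of the sum of `n` and the genus computes to `N + g`.
      ≡⟨ cong (λ c → + e S * N - + c) (n+genus≡conductor S S≢ℕ) ⟨
    + e S * N - (N + g)
      ≡⟨ cancel (+ e S) N g l s ⟩
    + e S * N - (l + s) - N + s + (l - g)
      ≡⟨ cong₂ (λ m θ → + e S * N - m - N + s + θ) l+s≡t*N (sym (Θ≡Λ-genus S S≢ℕ)) ⟩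
    + e S * N - t * N - N + s + Θ S S≢ℕ
      ≡⟨ cong (λ m → m + s + Θ S S≢ℕ) (collect (+ e S) t N) ⟩
    (+ e S - t - 1ℤ) * N + s + Θ S S≢ℕ ∎
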